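{- Let $k\ge 0$ be an integer and $d=2\cdot 2^{2k}$. Let $r$ be an odd positive integer with $r\ge\lceil\sqrt d\,\rceil$, and put $n=2^k r$ and $$a=2n+d=2\cdot2^k r+2\cdot 2^{2k},\qquad b=2n+\frac{2n^2}{d}=2\cdot 2^k r+r^2,\qquad c=b+d=2\cdot2^kr+r^2+2\cdot2^{2k}.$$ Then $(a,b,c)$ is an IDPT. Moreover, every IDPT $(a,b,c)$ with $c-b=2\cdot 2^{2k}$ arises in this way from some such $r$.
   Context: A Diophantine Pythagorean Triangle (DPT) is a triple $(a,b,c)$ of positive integers with $a<b<c$ and $a^2+b^2=c^2$. An IDPT is a DPT with $\gcd(a,b,c)=1$. $\lceil x\rceil$ is the smallest integer $\ge x$. -}

module Defs where

open import Data.Nat.Base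
open import Data.Nat.Properties
open import Data.Nat.DivMod using (_/_)
open import Data.Nat.GCD using (gcd)
open import Data.Parity.Base using (1ℙ)
open import Relation.Binary.PropositionalEquality using (_≡_)
open import Relation.Nullary.Decidable.Core using (yes; no)

record IsDPT (a b c : ℕ) : Set where
  field
    0<a         : 0 < a
    a<b         : a < b
    b<c         : b < c
    pythagorean : a ^ 2 + b ^ 2 ≡ c ^ 2

record IsIDPT (a b c : ℕ) : Set where
  field
    isDPT : IsDPT a b c
    gcd≡1 : gcd (gcd a b) c ≡ 1

Odd : ℕ → Set
Odd n = parity n ≡ 1ℙ

-- Since √d ≤ m iff d ≤ m² for natural m, ⌈√ d ⌉ is the least natural m
-- with d ≤ m²; the two lemmas after the definition say that it is.
⌈√_⌉ : ℕ → ℕ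
⌈√ zero ⌉  = zero
⌈√ suc d ⌉ with suc d ≤? ⌈√ d ⌉ ^ 2
... | yes _ = ⌈√ d ⌉
... | no  _ = suc ⌈√ d ⌉

d≤⌈√d⌉² : ∀ d → d ≤ ⌈√ d ⌉ ^ 2
d≤⌈√d⌉² zero    = z≤n
d≤⌈√d⌉² (suc d) with suc d ≤? ⌈√ d ⌉ ^ 2
... | yes p = p
... | no  _ = ≤-<-trans (d≤⌈√d⌉² d) (^-monoˡ-< 2 (n<1+n ⌈√ d ⌉))

⌈√d⌉-least : ∀ d m → d ≤ m ^ 2 → ⌈√ d ⌉ ≤ m
⌈√d⌉-least zero    m _ = z≤n
⌈√d⌉-least (suc d) m d<m² with suc d ≤? ⌈√ d ⌉ ^ 2
... | yes _ = ⌈√d⌉-least d m (<⇒≤ d<m²)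
... | no ¬p = ≰⇒> λ m≤√d → ¬p (≤-trans d<m² (^-monoˡ-≤ 2 m≤√d))

diff : ℕ → ℕ
diff k = 2 * 2 ^ (2 * k)

diff-nonZero : ∀ k → NonZero (diff k)
diff-nonZero k = m*n≢0 2 (2 ^ (2 * k)) {{_}} {{m^n≢0 2 (2 * k)}}

scale : ℕ → ℕ → ℕ
scale k r = 2 ^ k * r

sideA sideB sideC : ℕ → ℕ → ℕ
sideA k r = 2 * scale k r + diff k
-- The floor in _/_ is harmless: 2n²/d = r² exactly, for n = scale k r and d = diff k.
sideB k r = 2 * scale k r + (2 * scale k r ^ 2 / diff k) {{diff-nonZero k}}
sideC k r = sideB k r + diff k

record Admissible (k r : ℕ) : Set where
  field
    odd      : Odd r
    positive : 0 < r
    ⌈√d⌉≤r   : ⌈√ diff k ⌉ ≤ r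

{-# OPTIONS --safe #-}
module Submission where

open import Defs
open import Data.Nat.Base using (ℕ; _+_; _*_; _∸_; _^_; _≤_; _<_; zero; suc; parity; >-nonZero⁻¹)
open import Data.Nat.Coprimality using (Coprime; coprime-divisor)
open import Data.Nat.Divisibility
open import Data.Nat.Divisibility.Core using (_∣_)
open import Data.Nat.DivMod using (m*n/n≡m; /-congˡ)
open import Data.Nat.GCD using (gcd; gcd[m,n]∣m; gcd[m,n]∣n; gcd-greatest)
open import Data.Nat.Primality using (Prime; prime[2]; irreducible[2]; euclidsLemma; prime⇒nonZero)
open import Data.Nat.Properties
open import Data.Nat.Solver using (module +-*-Solver)
open import Data.Parity.Base using (0ℙ; 1ℙ) renaming (_+_ to _+ℙ_; _*_ to _*ℙ_)
open import Data.Parity.Properties using (+-homo-+; *-homo-*) renaming (*-idem to *ℙ-idem)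
open import Data.Product.Base using (_×_; ∃-syntax; _,_)
open import Data.Sum.Base using (inj₁; inj₂; reduce)
open import Relation.Binary.PropositionalEquality
  using (_≡_; _≢_; refl; sym; trans; cong; cong₂; subst; subst₂; module ≡-Reasoning)
open import Relation.Nullary.Negation using (¬_; contradiction)

-- Put `t = 2 ^ k`, so that d = 2t² and n = tr. If c = b + d, then a² = c² - b² = (2t)²(b + t²).
-- Hence 2t divides a (`p^j^2∣n^2⇒p^j∣n`), and a = 2ts with s² = b + t². Substituting s = t + r
-- gives exactly a = 2tr + d and b = 2tr + r²; so the equation alone forces the parametrised shape
-- (`pythagorean⇒sides`), and conversely that shape satisfies it. The remaining conditions translate
-- into conditions on r. Cancelling 2tr, a < b says d < r²; for odd r this is the same as r ≥ ⌈√d⌉,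
-- since d is even and r² odd. The numbers a and d are even and b has the parity of r, so an even r
-- makes 2 a common divisor, while for odd r a common divisor is odd and divides c - b, a power of
-- 2, hence is 1.

parity≡0⇒2∣ : ∀ n → parity n ≡ 0ℙ → 2 ∣ n
parity≡0⇒2∣ zero          _  = 2 ∣0
parity≡0⇒2∣ (suc (suc n)) eq = ∣m∣n⇒∣m+n ∣-refl (parity≡0⇒2∣ n eq)

parity-2* : ∀ n → parity (2 * n) ≡ 0ℙ
parity-2* = *-homo-* 2

parity-^2 : ∀ n → parity (n ^ 2) ≡ parity n
parity-^2 n = begin
  parity (n ^ 2)           ≡⟨ cong (λ m → parity (n * m)) (*-identityʳ n) ⟩
  parity (n * n)           ≡⟨ *-homo-* n n ⟩
  (parity n *ℙ parity n)   ≡⟨ *ℙ-idem (parity n) ⟩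
  parity n                 ∎
  where open ≡-Reasoning

odd⇒2∤ : ∀ {n} → Odd n → ¬ 2 ∣ n
odd⇒2∤ odd (divides q refl) with () ← trans (sym odd) (trans (cong parity (*-comm q 2)) (parity-2* q))

-- An odd number is coprime to 2, so Gauss's lemma strips the factors 2 one at a time.
odd∧∣2^⇒≡1 : ∀ {m} → Odd m → ∀ j → m ∣ 2 ^ j → m ≡ 1
odd∧∣2^⇒≡1         odd zero    m∣1   = ∣1⇒≡1 m∣1
odd∧∣2^⇒≡1 {m} odd (suc j) m∣2^j = odd∧∣2^⇒≡1 odd j (coprime-divisor coprime m∣2^j)
  where
  coprime : Coprime m 2
  coprime (d∣m , d∣2) with irreducible[2] d∣2
  ... | inj₁ d≡1  = d≡1
  ... | inj₂ refl = contradiction d∣m (odd⇒2∤ odd)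

∣-odd : ∀ {m n} → m ∣ n → Odd n → Odd m
∣-odd {m} m∣n odd with parity m in eq
... | 1ℙ = refl
... | 0ℙ = contradiction (∣-trans (parity≡0⇒2∣ m eq) m∣n) (odd⇒2∤ odd)

^2-distrib : ∀ m n → (m * n) ^ 2 ≡ m ^ 2 * n ^ 2
^2-distrib = solve 2 (λ m n → (m :* n) :^ 2 := m :^ 2 :* n :^ 2) refl
  where open +-*-Solver

-- Induction on `j`: Euclid's lemma gives n = qp, and cancelling p² leaves the same statement for q
-- with exponent one lower.
p^j^2∣n^2⇒p^j∣n : ∀ {p} → Prime p → ∀ j {n} → (p ^ j) ^ 2 ∣ n ^ 2 → p ^ j ∣ n
p^j^2∣n^2⇒p^j∣n         _  zero        _  = 1∣ _
p^j^2∣n^2⇒p^j∣n {p} pp (suc j) {n} sq with p∣n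
  where
  p∣n : p ∣ n
  p∣n = reduce (euclidsLemma n n pp (subst (p ∣_) (cong (n *_) (*-identityʳ n))
          (∣-trans (∣-trans (m∣m*n (p ^ j)) (m∣m*n (p ^ suc j * 1))) sq)))
... | divides q refl = subst (_∣ q * p) (*-comm (p ^ j) p)
  (*-monoˡ-∣ {p ^ j} {q} p (p^j^2∣n^2⇒p^j∣n pp j (*-cancelʳ-∣ (p ^ 2) {{m^n≢0 p 2 {{prime⇒nonZero pp}}}}
    (subst₂ _∣_ (trans (cong (_^ 2) (*-comm p (p ^ j))) (^2-distrib (p ^ j) p)) (^2-distrib q p) sq))))

parity-2*m+n^2 : ∀ m n → parity (2 * m + n ^ 2) ≡ parity n
parity-2*m+n^2 m n = begin
  parity (2 * m + n ^ 2)                ≡⟨ +-homo-+ (2 * m) (n ^ 2) ⟩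
  (parity (2 * m) +ℙ parity (n ^ 2))    ≡⟨ cong₂ _+ℙ_ (parity-2* m) (parity-^2 n) ⟩
  parity n                              ∎
  where open ≡-Reasoning

2∣diff : ∀ k → 2 ∣ diff k
2∣diff k = m∣m*n (2 ^ (2 * k))

-- In this form every identity about the sides is polynomial in the two atoms `2 ^ k` and `r`,
-- within reach of the ring solver.
diff≡2*[2^k]^2 : ∀ k → diff k ≡ 2 * (2 ^ k) ^ 2
diff≡2*[2^k]^2 k = cong (2 *_) (trans (cong (2 ^_) (*-comm 2 k)) (sym (^-*-assoc 2 k 2)))

2*scale^2≡r^2*diff : ∀ k r → 2 * scale k r ^ 2 ≡ r ^ 2 * diff k
2*scale^2≡r^2*diff k r = trans
  (solve 2 (λ t r → con 2 :* (t :* r) :^ 2 := r :^ 2 :* (con 2 :* t :^ 2)) refl (2 ^ k) r)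
  (cong (r ^ 2 *_) (sym (diff≡2*[2^k]^2 k)))
  where open +-*-Solver

sideA≡ : ∀ k r → sideA k r ≡ 2 * 2 ^ k * r + diff k
sideA≡ k r = cong (_+ diff k) (sym (*-assoc 2 (2 ^ k) r))

sideB≡ : ∀ k r → sideB k r ≡ 2 * 2 ^ k * r + r ^ 2
sideB≡ k r = cong₂ _+_ (sym (*-assoc 2 (2 ^ k) r))
  (trans (/-congˡ {{diff-nonZero k}} (2*scale^2≡r^2*diff k r)) (m*n/n≡m (r ^ 2) (diff k) {{diff-nonZero k}}))

sideC≡ : ∀ k r → sideC k r ≡ 2 * 2 ^ k * r + r ^ 2 + diff k
sideC≡ k r = cong (_+ diff k) (sideB≡ k r)

-- Serves both directions: odd `r` makes common divisors odd, even `r` makes 2 one of them.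
parity-sideB : ∀ k r → parity (sideB k r) ≡ parity r
parity-sideB k r = begin
  parity (sideB k r)                 ≡⟨ cong parity (sideB≡ k r) ⟩
  parity (2 * 2 ^ k * r + r ^ 2)     ≡⟨ cong (λ m → parity (m + r ^ 2)) (*-assoc 2 (2 ^ k) r) ⟩
  parity (2 * (2 ^ k * r) + r ^ 2)   ≡⟨ parity-2*m+n^2 (2 ^ k * r) r ⟩
  parity r                           ∎
  where open ≡-Reasoning

-- With d = 2t², both a² and c² - b² equal (2t(t + r))².
sides-pythagorean : ∀ k r → sideA k r ^ 2 + sideB k r ^ 2 ≡ sideC k r ^ 2
sides-pythagorean k r rewrite sideC≡ k r | sideB≡ k r | sideA≡ k r | diff≡2*[2^k]^2 k =
  solve 2 (λ t r → (con 2 :* t :* r :+ con 2 :* t :^ 2) :^ 2 :+ (con 2 :* t :* r :+ r :^ 2) :^ 2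
                   := (con 2 :* t :* r :+ r :^ 2 :+ con 2 :* t :^ 2) :^ 2) refl (2 ^ k) r
  where open +-*-Solver

-- The ceiling only gives d ≤ r²; parity excludes equality, d being even and r² odd.
diff<r^2 : ∀ {k r} → Admissible k r → diff k < r ^ 2
diff<r^2 {k} {r} adm = ≤∧≢⇒< diff≤r^2 diff≢r^2
  where
  open Admissible adm
  diff≤r^2 : diff k ≤ r ^ 2
  diff≤r^2 = ≤-trans (d≤⌈√d⌉² (diff k)) (^-monoˡ-≤ 2 ⌈√d⌉≤r)
  diff≢r^2 : diff k ≢ r ^ 2
  diff≢r^2 eq = odd⇒2∤ (trans (parity-^2 r) odd) (subst (2 ∣_) eq (2∣diff k))

diff>0 : ∀ k → 0 < diff k
diff>0 k = >-nonZero⁻¹ (diff k) {{diff-nonZero k}}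

-- Primitivity: a common divisor divides b, which is odd like r, and c − b, a power of 2.
admissible⇒IsIDPT : ∀ {k r} → Admissible k r → IsIDPT (sideA k r) (sideB k r) (sideC k r)
admissible⇒IsIDPT {k} {r} adm = record
  { isDPT = record
    { 0<a         = ≤-trans (diff>0 k) (m≤n+m (diff k) (2 * scale k r))
    ; a<b         = subst₂ _<_ (sym (sideA≡ k r)) (sym (sideB≡ k r))
                      (+-monoʳ-< (2 * 2 ^ k * r) (diff<r^2 adm))
    ; b<c         = m<m+n (sideB k r) (diff>0 k)
    ; pythagorean = sides-pythagorean k r
    }
  ; gcd≡1 = odd∧∣2^⇒≡1 (∣-odd g∣b (trans (parity-sideB k r) odd)) (suc (2 * k))
              (∣m+n∣m⇒∣n (gcd[m,n]∣n (gcd (sideA k r) (sideB k r)) (sideC k r)) g∣b)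
  }
  where
  open Admissible adm
  g∣b : gcd (gcd (sideA k r) (sideB k r)) (sideC k r) ∣ sideB k r
  g∣b = ∣-trans (gcd[m,n]∣m (gcd (sideA k r) (sideB k r)) (sideC k r)) (gcd[m,n]∣n (sideA k r) (sideB k r))

-- Difference of squares, with b² added to both sides to avoid subtraction: c² - b² = 2t²(2b + 2t²).
a^2≡[b+t^2]*[2t]^2 : ∀ t a b → a ^ 2 + b ^ 2 ≡ (b + 2 * t ^ 2) ^ 2 → a ^ 2 ≡ (b + t ^ 2) * (2 * t) ^ 2
a^2≡[b+t^2]*[2t]^2 t a b pyth = +-cancelʳ-≡ (b ^ 2) _ _ (trans pyth
  (solve 2 (λ b t → (b :+ con 2 :* t :^ 2) :^ 2
                    := (b :+ t :^ 2) :* (con 2 :* t) :^ 2 :+ b :^ 2) refl b t))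
  where open +-*-Solver

-- With t = 2ᵏ, c = b + 2t² turns a² + b² = c² into a² = (2t)² (b + t²),
-- so a = 2ts with s² = b + t², and r = s − t.
pythagorean⇒sides : ∀ k a b → a ^ 2 + b ^ 2 ≡ (b + diff k) ^ 2 →
                    ∃[ r ] (a ≡ sideA k r × b ≡ sideB k r)
pythagorean⇒sides k a b pyth
  with a^2≡ ← a^2≡[b+t^2]*[2t]^2 (2 ^ k) a b (trans pyth (cong (λ d → (b + d) ^ 2) (diff≡2*[2^k]^2 k)))
  -- The exponent is `suc k` because `2 ^ suc k` unfolds to 2t.
  with p^j^2∣n^2⇒p^j∣n prime[2] (suc k) {a} (divides (b + (2 ^ k) ^ 2) a^2≡)
... | divides s refl = r , a≡ , b≡
  where
  open +-*-Solver
  open ≡-Reasoning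
  t = 2 ^ k
  r = s ∸ t
  s^2≡ : s ^ 2 ≡ b + t ^ 2
  s^2≡ = *-cancelʳ-≡ _ _ ((2 * t) ^ 2) {{m^n≢0 (2 * t) 2 {{m^n≢0 2 (suc k)}}}}
    (trans (sym (^2-distrib s (2 * t))) a^2≡)
  -- Makes the truncated subtraction in `r` exact; it holds because s² = b + t² ≥ t².
  t≤s : t ≤ s
  t≤s = ≮⇒≥ λ s<t → <⇒≱ (^-monoˡ-< 2 s<t) (subst (t ^ 2 ≤_) (sym s^2≡) (m≤n+m (t ^ 2) b))
  s≡ : t + r ≡ s
  s≡ = m+[n∸m]≡n t≤s
  a≡ : s * (2 * t) ≡ sideA k r
  a≡ = begin
    s * (2 * t)                ≡⟨ cong (_* (2 * t)) s≡ ⟨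
    (t + r) * (2 * t)          ≡⟨ solve 2 (λ t r → (t :+ r) :* (con 2 :* t)
                                    := con 2 :* t :* r :+ con 2 :* t :^ 2) refl t r ⟩
    2 * t * r + 2 * t ^ 2      ≡⟨ cong (2 * t * r +_) (diff≡2*[2^k]^2 k) ⟨
    2 * t * r + diff k         ≡⟨ sideA≡ k r ⟨
    sideA k r                  ∎
  b≡ : b ≡ sideB k r
  -- Adding t² completes the square: both sides become (t + r)².
  b≡ = +-cancelʳ-≡ (t ^ 2) _ _ (begin
    b + t ^ 2                      ≡⟨ s^2≡ ⟨
    s ^ 2                          ≡⟨ cong (_^ 2) s≡ ⟨
    (t + r) ^ 2                    ≡⟨ solve 2 (λ t r → (t :+ r) :^ 2
                                        := con 2 :* t :* r :+ r :^ 2 :+ t :^ 2) refl t r ⟩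
    2 * t * r + r ^ 2 + t ^ 2      ≡⟨ cong (_+ t ^ 2) (sideB≡ k r) ⟨
    sideB k r + t ^ 2              ∎)

IsIDPT⇒odd : ∀ k r → IsIDPT (sideA k r) (sideB k r) (sideC k r) → Odd r
IsIDPT⇒odd k r idpt with parity r in eq
... | 1ℙ = refl
... | 0ℙ = contradiction (subst (2 ∣_) (IsIDPT.gcd≡1 idpt) (gcd-greatest (gcd-greatest 2∣a 2∣b) 2∣c))
                         (odd⇒2∤ {1} refl)
  where
  2∣a : 2 ∣ sideA k r
  2∣a = ∣m∣n⇒∣m+n (m∣m*n (scale k r)) (2∣diff k)
  2∣b : 2 ∣ sideB k r
  2∣b = parity≡0⇒2∣ (sideB k r) (trans (parity-sideB k r) eq)
  2∣c : 2 ∣ sideC k r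
  2∣c = ∣m∣n⇒∣m+n 2∣b (2∣diff k)

IsIDPT⇒admissible : ∀ k r → IsIDPT (sideA k r) (sideB k r) (sideC k r) → Admissible k r
IsIDPT⇒admissible k r idpt = record
  { odd      = odd
  ; positive = n≢0⇒n>0 λ { refl → contradiction odd λ () }
  -- Cancelling 2tr from a < b leaves d < r², and the ceiling is the least number whose square
  -- reaches d.
  ; ⌈√d⌉≤r   = ⌈√d⌉-least (diff k) r (<⇒≤ (+-cancelˡ-< (2 * 2 ^ k * r) _ _
                 (subst₂ _<_ (sideA≡ k r) (sideB≡ k r) (IsDPT.a<b (IsIDPT.isDPT idpt)))))
  }
  where
  odd : Odd r
  odd = IsIDPT⇒odd k r idpt

theorem2 : (k : ℕ) →
    ((r : ℕ) → Admissible k r →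
    (diff k ∣ 2 * scale k r ^ 2)
    × (sideA k r ≡ 2 * 2 ^ k * r + 2 * 2 ^ (2 * k))
    × (sideB k r ≡ 2 * 2 ^ k * r + r ^ 2)
    × (sideC k r ≡ 2 * 2 ^ k * r + r ^ 2 + 2 * 2 ^ (2 * k))
    × IsIDPT (sideA k r) (sideB k r) (sideC k r))
    × ((a b c : ℕ) → IsIDPT a b c → c ∸ b ≡ 2 * 2 ^ (2 * k) →
    ∃[ r ] (Admissible k r
    × (a ≡ sideA k r) × (b ≡ sideB k r) × (c ≡ sideC k r)))
theorem2 k = forward , backward
  where
  forward : (r : ℕ) → Admissible k r → _
  forward r adm = divides (r ^ 2) (2*scale^2≡r^2*diff k r)
                , sideA≡ k r , sideB≡ k r , sideC≡ k r , admissible⇒IsIDPT adm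
  backward : (a b c : ℕ) → IsIDPT a b c → c ∸ b ≡ 2 * 2 ^ (2 * k) →
             ∃[ r ] (Admissible k r × (a ≡ sideA k r) × (b ≡ sideB k r) × (c ≡ sideC k r))
  backward a b c idpt c∸b≡d
    -- Since b < c, the truncated difference is exact and `c` is replaced by `b + diff k`; this is
    -- `sideC k r` by definition once `b` is `sideB k r`.
    with refl ← trans (sym (m+[n∸m]≡n (<⇒≤ (IsDPT.b<c (IsIDPT.isDPT idpt))))) (cong (b +_) c∸b≡d)
    with r , refl , refl ← pythagorean⇒sides k a b (IsDPT.pythagorean (IsIDPT.isDPT idpt))
    = r , IsIDPT⇒admissible k r idpt , refl , refl , refl
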